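{- Let $n,d$ be positive integers with $n\geq d\geq 3$. Then $$\mu(Q_n)\geq \frac{1}{d}\left(\sum_{r=d}^{n-d}\mathrm{ex}\left(n,\mathcal{D}_r(2d,d)\right)+2\sum_{r=0}^{d-1}\binom{n}{r}\right).$$
   Context: For a positive integer $n$, write $[n]=\{1,\dots,n\}$, and let $\binom{[n]}{r}$ be the family of all $r$-element subsets of $[n]$. The $n$-dimensional hypercube $Q_n$ is the graph on the vertex set $2^{[n]}$ (all subsets of $[n]$), where $A,B\in 2^{[n]}$ are adjacent if and only if $|A\Delta B|=1$, with $A\Delta B=(A\setminus B)\cup(B\setminus A)$. Let $G$ be a simple graph and $M\subseteq V(G)$. Two vertices $u,v\in V(G)$ are $M$-visible if there exists a shortest $u,v$-path in $G$ that contains no vertices from $M\setminus\{u,v\}$. The set $M$ is a mutual-visibility set if any two vertices $u,v\in M$ are $M$-visible. The mutual-visibility number $\mu(G)$ is the largest size of a mutual-visibility set in $G$. For positive integers $r,s,t$ with $\min\{r,s\}\geq t$, an $(r,s,t)$-daisy $\mathcal{D}_r(s,t)$ is a collection of all $r$-element sets $T$ satisfying $A\subseteq T\subseteq B$, for some given sets $A\subseteq B$ with $|A|=r-t$ and $|B|=r+s-t$. The Turán number $\mathrm{ex}(n,\mathcal{D}_r(s,t))$ is the largest size of a family $\mathcal{F}_r\subseteq\binom{[n]}{r}$ containing no $(r,s,t)$-daisy (as a subfamily). A sum over an empty range is $0$. -}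

module Defs where

open import Data.Bool.Properties using () renaming (_≟_ to _≟ᵇ_)
open import Data.Fin using (zero; suc)
open import Data.Fin.Properties using (injective⇒≤)
open import Data.Fin.Subset using (Subset; inside; outside; ∣_∣; _⊆_; _∪_; _─_)
open import Data.Fin.Subset.Properties using (_⊆?_; anySubset?; ∪-comm)
open import Data.Integer using (+_)
open import Data.List using (List; []; _∷_; length; map; filter; concatMap; cartesianProductWith; upTo; applyUpTo; head; last; lookup)
open import Data.List.Extrema.Nat using (max; xs≤max; argmax-sel)
open import Data.List.Membership.Propositional using (_∈_; find; lose)
open import Data.List.Membership.Propositional.Properties using (∈-lookup; ∈-filter⁺; ∈-filter⁻; ∈-map⁺; ∈-map⁻; ∈-concatMap⁺; ∈-cartesianProductWith⁺; ∈-upTo⁺)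
open import Data.List.Membership.Setoid.Properties using (index-injective)
open import Data.List.Relation.Unary.All as All using (All; []; _∷_; all?)
open import Data.List.Relation.Unary.AllPairs using ([]; _∷_)
open import Data.List.Relation.Unary.Any using (here; there; index; any?)
open import Data.List.Relation.Unary.Linked using (Linked; linked?)
open import Data.List.Relation.Unary.Unique.DecPropositional using (unique?)
open import Data.List.Relation.Unary.Unique.Propositional using (Unique)
open import Data.Maybe using (just)
import Data.Maybe.Properties as Maybe
open import Data.Nat using (ℕ; zero; suc; _+_; _∸_; _≤_; s≤s)
open import Data.Nat.ListAction using (sum)
open import Data.Nat.Properties using (_≟_; _≤?_; n≤0⇒n≡0)
open import Data.Product using (∃; ∃-syntax; _×_; _,_; proj₁; proj₂)
open import Data.Rational using (ℚ; _/_)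
open import Data.Sum using (_⊎_; inj₁; inj₂)
open import Data.Vec using ([]; _∷_)
import Data.Vec.Properties as Vec
open import Level using (0ℓ)
open import Relation.Binary using (DecidableEquality; Symmetric; Irreflexive) renaming (Decidable to Decidable₂)
open import Relation.Binary.PropositionalEquality using (_≡_; refl; sym; trans; cong; subst; setoid)
open import Relation.Nullary using (¬_; Dec; yes; no; contradiction)
open import Relation.Nullary.Decidable using (map′; ¬?; _×-dec_; _⊎-dec_; _→-dec_)
open import Relation.Unary using (Pred; Decidable)

private
  variable
    A : Set
    n : ℕ

record Finite (A : Set) : Set where
  field
    _≟ᴬ_     : DecidableEquality A
    elements : List A
    complete : ∀ x → x ∈ elements

-- A finite set of elements of A is represented by a duplicate-free list, and
-- its cardinality is the length of that list.

listsOfLength : List A → ℕ → List (List A)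
listsOfLength xs zero    = [] ∷ []
listsOfLength xs (suc k) = cartesianProductWith _∷_ xs (listsOfLength xs k)

module _ (F : Finite A) where
  open Finite F

  uniqueLists : List (List A)
  uniqueLists = filter (unique? _≟ᴬ_)
    (concatMap (listsOfLength elements) (upTo (suc (length elements))))

  private
    ∈-listsOfLength : (l : List A) → l ∈ listsOfLength elements (length l)
    ∈-listsOfLength []      = here refl
    ∈-listsOfLength (x ∷ l) =
      ∈-cartesianProductWith⁺ _∷_ (complete x) (∈-listsOfLength l)

    lookup-injective : {l : List A} → Unique l →
                       ∀ {i j} → lookup l i ≡ lookup l j → i ≡ j
    lookup-injective (x∉ ∷ u) {zero}  {zero}  eq = refl
    lookup-injective (x∉ ∷ u) {zero}  {suc j} eq =
      contradiction eq (All.lookup x∉ (∈-lookup j))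
    lookup-injective (x∉ ∷ u) {suc i} {zero}  eq =
      contradiction (sym eq) (All.lookup x∉ (∈-lookup i))
    lookup-injective (x∉ ∷ u) {suc i} {suc j} eq = cong suc (lookup-injective u eq)

    unique-length : {l : List A} → Unique l → length l ≤ length elements
    unique-length {l} u = injective⇒≤ {f = λ i → index (complete (lookup l i))}
      (λ eq → lookup-injective u (index-injective (setoid A) (complete _) (complete _) eq))

  ∈-uniqueLists⁺ : {l : List A} → Unique l → l ∈ uniqueLists
  ∈-uniqueLists⁺ {l} u = ∈-filter⁺ (unique? _≟ᴬ_)
    (∈-concatMap⁺ (listsOfLength elements)
      (lose (∈-upTo⁺ (s≤s (unique-length u))) (∈-listsOfLength l))) u

  ∈-uniqueLists⁻ : {l : List A} → l ∈ uniqueLists → Unique l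
  ∈-uniqueLists⁻ l∈ = proj₂ (∈-filter⁻ (unique? _≟ᴬ_)
    {xs = concatMap (listsOfLength elements) (upTo (suc (length elements)))} l∈)

  -- The largest size of a set satisfying P (0 if there is no such set).
  largestSize : {P : Pred (List A) 0ℓ} → Decidable P → ℕ
  largestSize P? = max 0 (map length (filter P? uniqueLists))

  largestSize-bound : {P : Pred (List A) 0ℓ} (P? : Decidable P) {l : List A} →
                      Unique l → P l → length l ≤ largestSize P?
  largestSize-bound P? u Pl = All.lookup (xs≤max 0 (map length (filter P? uniqueLists)))
    (∈-map⁺ length (∈-filter⁺ P? (∈-uniqueLists⁺ u) Pl))

  largestSize-attained : {P : Pred (List A) 0ℓ} (P? : Decidable P) {l : List A} →
                         Unique l → P l →
                         ∃[ m ] Unique m × P m × length m ≡ largestSize P?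
  largestSize-attained P? {l} u Pl
    with argmax-sel (λ k → k) 0 (map length (filter P? uniqueLists))
  ... | inj₁ eq = l , u , Pl ,
        trans (n≤0⇒n≡0 (subst (length l ≤_) eq (largestSize-bound P? u Pl))) (sym eq)
  ... | inj₂ ∈lengths with ∈-map⁻ length ∈lengths
  ...   | m , m∈ , eq with ∈-filter⁻ P? {xs = uniqueLists} m∈
  ...     | m∈u , Pm = m , ∈-uniqueLists⁻ m∈u , Pm , sym eq

record SimpleGraph : Set₁ where
  field
    Vertex      : Set
    finite      : Finite Vertex
    Adjacent    : Vertex → Vertex → Set
    adjacent?   : Decidable₂ Adjacent
    symmetric   : Symmetric Adjacent
    irreflexive : Irreflexive _≡_ Adjacent

  open Finite finite public renaming (_≟ᴬ_ to _≟ⱽ_)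

-- Paths are lists of vertices, so comparing numbers of vertices is the same as
-- comparing numbers of edges.
module _ (G : SimpleGraph) where
  open SimpleGraph G

  IsPath : Vertex → Vertex → List Vertex → Set
  IsPath u v p = Unique p × Linked Adjacent p × head p ≡ just u × last p ≡ just v

  IsShortestPath : Vertex → Vertex → List Vertex → Set
  IsShortestPath u v p = IsPath u v p × (∀ q → IsPath u v q → length p ≤ length q)

  Visible : List Vertex → Vertex → Vertex → Set
  Visible M u v =
    ∃[ p ] IsShortestPath u v p × (∀ {w} → w ∈ p → w ∈ M → w ≡ u ⊎ w ≡ v)

  MutualVisibility : List Vertex → Set
  MutualVisibility M = ∀ {u v} → u ∈ M → v ∈ M → Visible M u v

  private
    isPath? : ∀ u v → Decidable (IsPath u v)
    isPath? u v p = unique? _≟ⱽ_ p ×-dec linked? adjacent? p ×-dec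
      Maybe.≡-dec _≟ⱽ_ (head p) (just u) ×-dec Maybe.≡-dec _≟ⱽ_ (last p) (just v)

    isShortestPath? : ∀ u v → Decidable (IsShortestPath u v)
    isShortestPath? u v p = isPath? u v p ×-dec
      map′ (λ all q path → All.lookup all (∈-uniqueLists⁺ finite (proj₁ path)) path)
           (λ min → All.tabulate λ {q} _ → min q)
           (all? (λ q → isPath? u v q →-dec (length p ≤? length q)) (uniqueLists finite))

    memb? : (w : Vertex) (M : List Vertex) → Dec (w ∈ M)
    memb? w = any? (w ≟ⱽ_)

    visible? : ∀ M u v → Dec (Visible M u v)
    visible? M u v =
      map′ (λ a → let p , _ , h = find a in p , h)
           (λ { (p , h) → lose (∈-uniqueLists⁺ finite (proj₁ (proj₁ (proj₁ h)))) h })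
           (any? (λ p → isShortestPath? u v p ×-dec avoids? p) (uniqueLists finite))
      where
      avoids? : ∀ p → Dec (∀ {w} → w ∈ p → w ∈ M → w ≡ u ⊎ w ≡ v)
      avoids? p = map′ (λ all w∈p → All.lookup all w∈p) (λ f → All.tabulate f)
        (all? (λ w → memb? w M →-dec ((w ≟ⱽ u) ⊎-dec (w ≟ⱽ v))) p)

  mutualVisibility? : Decidable MutualVisibility
  mutualVisibility? M =
    map′ (λ all u∈M v∈M → All.lookup (All.lookup all u∈M) v∈M)
         (λ mv → All.tabulate λ u∈M → All.tabulate λ v∈M → mv u∈M v∈M)
         (all? (λ u → all? (visible? M u) M) M)

  μ : ℕ
  μ = largestSize finite mutualVisibility?

allSubsets : ∀ n → List (Subset n)
allSubsets zero    = [] ∷ []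
allSubsets (suc n) =
  cartesianProductWith _∷_ (inside ∷ outside ∷ []) (allSubsets n)

subsetFinite : ∀ n → Finite (Subset n)
subsetFinite n = record
  { _≟ᴬ_     = Vec.≡-dec _≟ᵇ_
  ; elements = allSubsets n
  ; complete = complete′
  }
  where
  side : ∀ s → s ∈ (inside ∷ outside ∷ [])
  side inside  = here refl
  side outside = there (here refl)

  complete′ : ∀ {m} (S : Subset m) → S ∈ allSubsets m
  complete′ []      = here refl
  complete′ (s ∷ S) = ∈-cartesianProductWith⁺ _∷_ (side s) (complete′ S)

infixl 6 _△_

_△_ : Subset n → Subset n → Subset n
S △ T = (S ─ T) ∪ (T ─ S)

Q : ℕ → SimpleGraph
Q n = record
  { Vertex      = Subset n
  ; finite      = subsetFinite n
  ; Adjacent    = λ S T → ∣ S △ T ∣ ≡ 1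
  ; adjacent?   = λ S T → ∣ S △ T ∣ ≟ 1
  ; symmetric   = λ {S} {T} eq → trans (cong ∣_∣ (∪-comm (T ─ S) (S ─ T))) eq
  ; irreflexive = λ { {S} refl eq → contradiction (trans (sym (△-self S)) eq) λ () }
  }
  where
  △-self : ∀ {m} (S : Subset m) → ∣ S △ S ∣ ≡ 0
  △-self []            = refl
  △-self (inside ∷ S)  = △-self S
  △-self (outside ∷ S) = △-self S

UniformFamily : ℕ → List (Subset n) → Set
UniformFamily r 𝓕 = All (λ T → ∣ T ∣ ≡ r) 𝓕

-- The differences are exact in the intended range t ≤ r, t ≤ s.
ContainsDaisy : (r s t : ℕ) → List (Subset n) → Set
ContainsDaisy r s t 𝓕 =
  ∃[ A ] ∃[ B ] A ⊆ B × ∣ A ∣ ≡ r ∸ t × ∣ B ∣ ≡ r + s ∸ t ×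
    (∀ T → ∣ T ∣ ≡ r → A ⊆ T → T ⊆ B → T ∈ 𝓕)

DaisyFreeFamily : (r s t : ℕ) → List (Subset n) → Set
DaisyFreeFamily r s t 𝓕 = UniformFamily r 𝓕 × ¬ ContainsDaisy r s t 𝓕

private
  containsDaisy? : ∀ r s t → Decidable (ContainsDaisy {n} r s t)
  containsDaisy? {n} r s t 𝓕 = anySubset? λ A → anySubset? λ B →
    (A ⊆? B) ×-dec (∣ A ∣ ≟ (r ∸ t)) ×-dec (∣ B ∣ ≟ (r + s ∸ t)) ×-dec
    map′ (λ all T → All.lookup all (complete T)) (λ f → All.tabulate λ {T} _ → f T)
      (all? (λ T → (∣ T ∣ ≟ r) →-dec ((A ⊆? T) →-dec ((T ⊆? B) →-dec
              any? (T ≟ᴬ_) 𝓕))) elements)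
    where open Finite (subsetFinite n)

daisyFreeFamily? : ∀ r s t → Decidable (DaisyFreeFamily {n} r s t)
daisyFreeFamily? r s t 𝓕 = all? (λ T → ∣ T ∣ ≟ r) 𝓕 ×-dec ¬? (containsDaisy? r s t 𝓕)

-- ex n r s t is the Turán number of the (r, s, t)-daisy in [n].
ex : (n r s t : ℕ) → ℕ
ex n r s t = largestSize (subsetFinite n) (daisyFreeFamily? r s t)

-- Both bounds are inclusive; the sum is 0 when b < a.
sumFromTo : (a b : ℕ) → (ℕ → ℕ) → ℕ
sumFromTo a b f = sum (applyUpTo (λ i → f (a + i)) (suc b ∸ a))

infix 5 sumFromTo
syntax sumFromTo a b (λ r → e) = Σ[ r from a to b ] e

fromℕ : ℕ → ℚ
fromℕ k = + k / 1

module Submission where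

{-
Let M be a union of full or daisy-free layers whose indices are congruent modulo
d ≥ 3. From A to B with |A| ≤ |B| one can walk along a geodesic that zigzags in
the two layers above |A| until A ∖ B is exhausted, and then climbs; it meets M
only where it has to cross a layer of M, and there a missing set of a daisy lets
it pass. Such M are therefore mutual-visibility sets, and for n ≥ 2d averaging
over the d residue classes gives the bound.

For n < 2d the sum of Turán numbers is empty, but layers with n - d < r < d are
counted twice on the right-hand side. The same zigzag shows that two full layers
at distance at least 3 form a mutual-visibility set. The multiset consisting of
the layers 0, …, d-1 and n-d+1, …, n can be split into d such pairs, and averaging
over these pairs gives the bound, unless d ≤ n ≤ d+1 and n ≤ 6; there, explicit
sets of sizes 5, 8, 13, 23 in Q₃, Q₄, Q₅, Q₆ suffice.
-}

open import Defs
open import Data.Integer using (+_)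
open import Data.Nat using (ℕ; NonZero; _+_; _*_; _∸_) renaming (_≥_ to _≥ᴺ_)
open import Data.Nat.Combinatorics using (_C_)
open import Data.Rational using (_/_; _≥_) renaming (_*_ to _*ᴿ_)

open import Data.Bool using (Bool; T; if_then_else_; _xor_)
open import Data.Bool.ListAction using (all)
open import Data.Empty using (⊥-elim)
open import Data.Fin.Subset using (Subset; inside; outside; ∣_∣; _⊆_; _∩_; _─_)
open import Data.Fin.Subset.Properties using (_⊆?_; anySubset?; drop-∷-⊆; out⊆; p∩q⊆q; s⊆s; ∣p∩q∣≤∣p∣; ∣p∣≤n; ∪-comm; ⊆-trans)
import Data.Integer as ℤ
import Data.Integer.Properties as ℤ
open import Data.List using (List; []; _∷_; _++_; applyUpTo; foldr; head; last; length; map)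
open import Data.List.Membership.Propositional using (_∈_; _∉_)
open import Data.List.Membership.Propositional.Properties using (∈-++⁻; ∈-map⁻)
open import Data.List.Properties using (length-++; length-map)
open import Data.List.Relation.Binary.Disjoint.Propositional using (Disjoint)
open import Data.List.Relation.Unary.All as All using ([]; _∷_)
import Data.List.Relation.Unary.All.Properties as All
open import Data.List.Relation.Unary.AllPairs using ([]; _∷_)
open import Data.List.Relation.Unary.Any using (here; there; any?)
open import Data.List.Relation.Unary.Linked using (Linked; [-]; _∷_)
open import Data.List.Relation.Unary.Unique.DecPropositional using (unique?)
open import Data.List.Relation.Unary.Unique.Propositional using (Unique)
open import Data.List.Relation.Unary.Unique.Propositional.Properties using (map⁺; ++⁺)
open import Data.Maybe using (Maybe; just; nothing; is-just; _<∣>_; _>>=_)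
open import Data.Nat using (zero; suc; _≤_; _<_; _≡ᵇ_; _%_; ⌊_/2⌋; z≤n; s≤s; s≤s⁻¹; >-nonZero)
open import Data.Nat.Combinatorics using (nCk≡nC[n∸k]; nCn≡1; nCk+nC[k+1]≡[n+1]C[k+1])
open import Data.Nat.Combinatorics.Specification using (k>n⇒nCk≡0)
open import Data.Nat.ListAction using (sum)
open import Data.Nat.Properties
open import Data.Nat.Tactic.RingSolver using (solve-∀)
open import Data.Product using (∃-syntax; _×_; _,_; proj₁)
import Data.Rational as ℚ
import Data.Rational.Properties as ℚ
import Data.Rational.Unnormalised as ℚᵘ
import Data.Rational.Unnormalised.Properties as ℚᵘ
open import Data.Sum as Sum using (_⊎_; inj₁; inj₂; [_,_]′; swap)
open import Data.Unit using (tt)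
open import Data.Vec as Vec using ([]; _∷_)
open import Data.Vec.Properties using (∷-injectiveʳ)
open import Function using (_∘_)
open import Relation.Binary.PropositionalEquality using (_≡_; refl; sym; trans; cong; cong₂; subst; subst₂; module ≡-Reasoning)
open import Relation.Nullary using (¬_; Dec; yes; no; contradiction)
open import Relation.Nullary.Decidable using (True; toWitness; decidable-stable; dec⇒maybe; ¬?; _×-dec_; _→-dec_; _⊎-dec_)
open import Relation.Unary using (Decidable)

private
  variable
    n k l : ℕ
    A B V : Subset n
    P R : Subset n → Set

-- Set differences and Hamming distance.

∣p△p∣≡0 : (A : Subset n) → ∣ A △ A ∣ ≡ 0
∣p△p∣≡0 []            = refl
∣p△p∣≡0 (inside ∷ A)  = ∣p△p∣≡0 A
∣p△p∣≡0 (outside ∷ A) = ∣p△p∣≡0 A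

△-comm : (A B : Subset n) → A △ B ≡ B △ A
△-comm A B = ∪-comm (A ─ B) (B ─ A)

∣p△q∣≡∣p─q∣+∣q─p∣ : (A B : Subset n) → ∣ A △ B ∣ ≡ ∣ A ─ B ∣ + ∣ B ─ A ∣
∣p△q∣≡∣p─q∣+∣q─p∣ []            []            = refl
∣p△q∣≡∣p─q∣+∣q─p∣ (inside ∷ A)  (inside ∷ B)  = ∣p△q∣≡∣p─q∣+∣q─p∣ A B
∣p△q∣≡∣p─q∣+∣q─p∣ (inside ∷ A)  (outside ∷ B) = cong suc (∣p△q∣≡∣p─q∣+∣q─p∣ A B)
∣p△q∣≡∣p─q∣+∣q─p∣ (outside ∷ A) (inside ∷ B)  =
  trans (cong suc (∣p△q∣≡∣p─q∣+∣q─p∣ A B)) (sym (+-suc ∣ A ─ B ∣ ∣ B ─ A ∣))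
∣p△q∣≡∣p─q∣+∣q─p∣ (outside ∷ A) (outside ∷ B) = ∣p△q∣≡∣p─q∣+∣q─p∣ A B

∣p∣+∣q─p∣≡∣q∣+∣p─q∣ : (A B : Subset n) → ∣ A ∣ + ∣ B ─ A ∣ ≡ ∣ B ∣ + ∣ A ─ B ∣
∣p∣+∣q─p∣≡∣q∣+∣p─q∣ []            []            = refl
∣p∣+∣q─p∣≡∣q∣+∣p─q∣ (inside ∷ A)  (inside ∷ B)  = cong suc (∣p∣+∣q─p∣≡∣q∣+∣p─q∣ A B)
∣p∣+∣q─p∣≡∣q∣+∣p─q∣ (inside ∷ A)  (outside ∷ B) =
  trans (cong suc (∣p∣+∣q─p∣≡∣q∣+∣p─q∣ A B)) (sym (+-suc ∣ B ∣ ∣ A ─ B ∣))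
∣p∣+∣q─p∣≡∣q∣+∣p─q∣ (outside ∷ A) (inside ∷ B)  =
  trans (+-suc ∣ A ∣ ∣ B ─ A ∣) (cong suc (∣p∣+∣q─p∣≡∣q∣+∣p─q∣ A B))
∣p∣+∣q─p∣≡∣q∣+∣p─q∣ (outside ∷ A) (outside ∷ B) = ∣p∣+∣q─p∣≡∣q∣+∣p─q∣ A B

∣p─q∣≡0∧∣q─p∣≡0⇒p≡q : (A B : Subset n) → ∣ A ─ B ∣ ≡ 0 → ∣ B ─ A ∣ ≡ 0 → A ≡ B
∣p─q∣≡0∧∣q─p∣≡0⇒p≡q []            []            _ _ = refl
∣p─q∣≡0∧∣q─p∣≡0⇒p≡q (inside ∷ A)  (inside ∷ B)  p q =
  cong (inside ∷_) (∣p─q∣≡0∧∣q─p∣≡0⇒p≡q A B p q)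
∣p─q∣≡0∧∣q─p∣≡0⇒p≡q (outside ∷ A) (outside ∷ B) p q =
  cong (outside ∷_) (∣p─q∣≡0∧∣q─p∣≡0⇒p≡q A B p q)

△-triangle : (A B V : Subset n) → ∣ A △ V ∣ ≤ ∣ A △ B ∣ + ∣ B △ V ∣
△-triangle []            []            []            = z≤n
△-triangle (inside ∷ A)  (inside ∷ B)  (inside ∷ V)  = △-triangle A B V
△-triangle (inside ∷ A)  (inside ∷ B)  (outside ∷ V) =
  ≤-trans (s≤s (△-triangle A B V)) (≤-reflexive (sym (+-suc ∣ A △ B ∣ ∣ B △ V ∣)))
△-triangle (inside ∷ A)  (outside ∷ B) (inside ∷ V)  =
  ≤-trans (△-triangle A B V) (≤-trans (+-monoʳ-≤ ∣ A △ B ∣ (n≤1+n _)) (n≤1+n _))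
△-triangle (inside ∷ A)  (outside ∷ B) (outside ∷ V) = s≤s (△-triangle A B V)
△-triangle (outside ∷ A) (inside ∷ B)  (inside ∷ V)  = s≤s (△-triangle A B V)
△-triangle (outside ∷ A) (inside ∷ B)  (outside ∷ V) =
  ≤-trans (△-triangle A B V) (≤-trans (+-monoʳ-≤ ∣ A △ B ∣ (n≤1+n _)) (n≤1+n _))
△-triangle (outside ∷ A) (outside ∷ B) (inside ∷ V)  =
  ≤-trans (s≤s (△-triangle A B V)) (≤-reflexive (sym (+-suc ∣ A △ B ∣ ∣ B △ V ∣)))
△-triangle (outside ∷ A) (outside ∷ B) (outside ∷ V) = △-triangle A B V

-- In each position `V` agrees with `A` or with `B`, so it lies on a geodesic between them.
△-between : (A B V : Subset n) → A ∩ B ⊆ V → V ⊆ B →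
            ∣ A △ V ∣ + ∣ V △ B ∣ ≡ ∣ A △ B ∣
△-between []            []            []            _ _ = refl
△-between (a ∷ A)       (outside ∷ B) (inside ∷ V)  p q with () ← q Vec.here
△-between (inside ∷ A)  (inside ∷ B)  (outside ∷ V) p q with () ← p Vec.here
△-between (inside ∷ A)  (inside ∷ B)  (inside ∷ V)  p q =
  △-between A B V (drop-∷-⊆ p) (drop-∷-⊆ q)
△-between (inside ∷ A)  (outside ∷ B) (outside ∷ V) p q =
  cong suc (△-between A B V (drop-∷-⊆ p) (drop-∷-⊆ q))
△-between (outside ∷ A) (inside ∷ B)  (inside ∷ V)  p q =
  cong suc (△-between A B V (drop-∷-⊆ p) (drop-∷-⊆ q))
△-between (outside ∷ A) (inside ∷ B)  (outside ∷ V) p q =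
  trans (+-suc ∣ A △ V ∣ ∣ V △ B ∣) (cong suc (△-between A B V (drop-∷-⊆ p) (drop-∷-⊆ q)))
△-between (outside ∷ A) (outside ∷ B) (outside ∷ V) p q =
  △-between A B V (drop-∷-⊆ p) (drop-∷-⊆ q)

insertTowards : (A B : Subset n) → ∣ B ─ A ∣ ≡ suc k →
  ∃[ V ] ∣ A △ V ∣ ≡ 1 × ∣ V ∣ ≡ suc ∣ A ∣ × ∣ V ─ B ∣ ≡ ∣ A ─ B ∣ × ∣ B ─ V ∣ ≡ k
insertTowards [] [] ()
insertTowards (outside ∷ A) (inside ∷ B)  eq =
  inside ∷ A , cong suc (∣p△p∣≡0 A) , refl , refl , suc-injective eq
insertTowards (inside ∷ A)  (inside ∷ B)  eq =
  let V , A△V , V∣ , V─B , B─V = insertTowards A B eq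
  in inside ∷ V , A△V , cong suc V∣ , V─B , B─V
insertTowards (inside ∷ A)  (outside ∷ B) eq =
  let V , A△V , V∣ , V─B , B─V = insertTowards A B eq
  in inside ∷ V , A△V , cong suc V∣ , cong suc V─B , B─V
insertTowards (outside ∷ A) (outside ∷ B) eq =
  let V , A△V , V∣ , V─B , B─V = insertTowards A B eq
  in outside ∷ V , A△V , V∣ , V─B , B─V

deleteTowards : (A B : Subset n) → ∣ A ─ B ∣ ≡ suc k →
  ∃[ V ] ∣ A △ V ∣ ≡ 1 × suc ∣ V ∣ ≡ ∣ A ∣ × ∣ V ─ B ∣ ≡ k × ∣ B ─ V ∣ ≡ ∣ B ─ A ∣
deleteTowards [] [] ()
deleteTowards (inside ∷ A)  (outside ∷ B) eq =
  outside ∷ A , cong suc (∣p△p∣≡0 A) , refl , suc-injective eq , refl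
deleteTowards (inside ∷ A)  (inside ∷ B)  eq =
  let V , A△V , V∣ , V─B , B─V = deleteTowards A B eq
  in inside ∷ V , A△V , cong suc V∣ , V─B , B─V
deleteTowards (outside ∷ A) (inside ∷ B)  eq =
  let V , A△V , V∣ , V─B , B─V = deleteTowards A B eq
  in outside ∷ V , A△V , V∣ , V─B , cong suc B─V
deleteTowards (outside ∷ A) (outside ∷ B) eq =
  let V , A△V , V∣ , V─B , B─V = deleteTowards A B eq
  in outside ∷ V , A△V , V∣ , V─B , B─V

⊆-interpolate : ∀ m (A B : Subset n) → A ⊆ B → ∣ A ∣ ≤ m → m ≤ ∣ B ∣ →
                ∃[ V ] A ⊆ V × V ⊆ B × ∣ V ∣ ≡ m
⊆-interpolate zero    []            []            A⊆B _ _ = [] , (λ x → x) , (λ x → x) , refl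
⊆-interpolate m       (inside ∷ A)  (outside ∷ B) A⊆B _ _ with () ← A⊆B Vec.here
⊆-interpolate (suc m) (inside ∷ A)  (inside ∷ B)  A⊆B (s≤s lo) (s≤s hi) =
  let V , A⊆V , V⊆B , eq = ⊆-interpolate m A B (drop-∷-⊆ A⊆B) lo hi
  in inside ∷ V , s⊆s A⊆V , s⊆s V⊆B , cong suc eq
⊆-interpolate m       (outside ∷ A) (outside ∷ B) A⊆B lo hi =
  let V , A⊆V , V⊆B , eq = ⊆-interpolate m A B (drop-∷-⊆ A⊆B) lo hi
  in outside ∷ V , s⊆s A⊆V , s⊆s V⊆B , eq
⊆-interpolate m       (outside ∷ A) (inside ∷ B)  A⊆B lo hi with m ≤? ∣ B ∣
... | yes m≤∣B∣ =
  let V , A⊆V , V⊆B , eq = ⊆-interpolate m A B (drop-∷-⊆ A⊆B) lo m≤∣B∣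
  in outside ∷ V , s⊆s A⊆V , out⊆ V⊆B , eq
-- Here `hi` forces `m` to be `suc ∣ B ∣`, so only the whole upper set has the right size.
... | no  m≰∣B∣ =
  inside ∷ B , out⊆ (drop-∷-⊆ A⊆B) , (λ x → x) , ≤-antisym (≰⇒> m≰∣B∣) hi

-- Walks, geodesics and visibility.

-- A walk with k edges all of whose vertices, except possibly the first,
-- satisfy P.
data Walk {n} (P : Subset n → Set) : ℕ → Subset n → Subset n → Set where
  []   : Walk P 0 A A
  step : ∣ A △ V ∣ ≡ 1 → P V → Walk P k V B → Walk P (suc k) A B

infixr 5 _++ʷ_

_++ʷ_ : Walk P k A B → Walk P l B V → Walk P (k + l) A V
[]         ++ʷ w′ = w′
step e p w ++ʷ w′ = step e p (w ++ʷ w′)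

mapʷ : (∀ {V} → P V → R V) → Walk P k A B → Walk R k A B
mapʷ f []           = []
mapʷ f (step e p w) = step e (f p) (mapʷ f w)

reverseʷ : P A → Walk P k A B → Walk P k B A
reverseʷ pA [] = []
reverseʷ {P = P} {A = A} {B = B} pA (step {V = V} {k = k} e p w) =
  subst (λ m → Walk P m B A) (+-comm k 1)
    (reverseʷ p w ++ʷ step (trans (cong ∣_∣ (△-comm V A)) e) pA [])

vertices : {P : Subset n → Set} {A B : Subset n} → Walk P k A B → List (Subset n)
vertices {A = A} []           = A ∷ []
vertices {A = A} (step _ _ w) = A ∷ vertices w

length-vertices : (w : Walk P k A B) → length (vertices w) ≡ suc k
length-vertices []           = refl
length-vertices (step _ _ w) = cong suc (length-vertices w)

head-vertices : (w : Walk P k A B) → head (vertices w) ≡ just A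
head-vertices []           = refl
head-vertices (step _ _ _) = refl

last-vertices : (w : Walk P k A B) → last (vertices w) ≡ just B
last-vertices []                        = refl
last-vertices (step _ _ [])             = refl
last-vertices (step _ _ w@(step _ _ _)) = last-vertices w

vertices-linked : (w : Walk P k A B) → Linked (SimpleGraph.Adjacent (Q n)) (vertices {n = n} w)
vertices-linked []                        = [-]
vertices-linked (step e _ [])             = e ∷ [-]
vertices-linked (step e _ w@(step _ _ _)) = e ∷ vertices-linked w

∈-vertices : (w : Walk P k A B) → V ∈ vertices w → V ≡ A ⊎ P V
∈-vertices []           (here refl)  = inj₁ refl
∈-vertices (step _ _ _) (here refl)  = inj₁ refl
∈-vertices (step _ p w) (there V∈w) with ∈-vertices w V∈w
... | inj₁ refl = inj₂ p
... | inj₂ pV   = inj₂ pV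

head∈vertices : (w : Walk P k A B) → A ∈ vertices w
head∈vertices []           = here refl
head∈vertices (step _ _ _) = here refl

△-step : (A B V : Subset n) → ∣ A △ V ∣ ≡ 1 → ∣ A △ B ∣ ≤ suc ∣ V △ B ∣
△-step A B V e = subst (λ m → ∣ A △ B ∣ ≤ m + ∣ V △ B ∣) e (△-triangle A V B)

△-vertices : (w : Walk P k A B) → V ∈ vertices w → ∣ V △ B ∣ ≤ k
△-vertices {A = A} [] (here refl) = ≤-reflexive (∣p△p∣≡0 A)
△-vertices {A = A} {B = B} (step {V = V} e _ w) (here refl) =
  ≤-trans (△-step A B V e) (s≤s (△-vertices w (head∈vertices w)))
△-vertices (step _ _ w) (there V∈w) = m≤n⇒m≤1+n (△-vertices w V∈w)

-- In a walk of length `∣ A △ B ∣` the distance to `B` drops at every step: the vertices after the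
-- first are at distance at most `k` from `B`, the first at distance `suc k`.
vertices-unique : (w : Walk P k A B) → ∣ A △ B ∣ ≡ k → Unique (vertices w)
vertices-unique [] _ = [] ∷ []
vertices-unique {A = A} {B = B} (step {V = V} {k = k} e _ w) eq =
  All.tabulate (λ { D∈w refl → <-irrefl eq (s≤s (△-vertices w D∈w)) })
  ∷ vertices-unique w (≤-antisym (△-vertices w (head∈vertices w))
      (s≤s⁻¹ (subst (_≤ suc ∣ V △ B ∣) eq (△-step A B V e))))

-- One edge lowers the distance to `B` by at most one. This makes a walk of length `∣ A △ B ∣` a
-- shortest path.
path-length : (q : List (Subset n)) → Linked (SimpleGraph.Adjacent (Q n)) q →
              head q ≡ just A → last q ≡ just B → suc ∣ A △ B ∣ ≤ length q
path-length (A ∷ [])    _       refl refl = s≤s (≤-reflexive (∣p△p∣≡0 A))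
path-length {B = B} (A ∷ V ∷ q) (e ∷ l) refl eq =
  s≤s (≤-trans (△-step A B V e) (path-length (V ∷ q) l refl eq))

Avoids : List (Subset n) → Subset n → Subset n → Subset n → Set
Avoids M A B V = V ∈ M → V ≡ A ⊎ V ≡ B

geodesic⇒visible : (M : List (Subset n)) → Walk (Avoids M A B) ∣ A △ B ∣ A B → Visible (Q n) M A B
geodesic⇒visible {n} {A} {B} M w =
  vertices w ,
  ((vertices-unique w refl , vertices-linked w , head-vertices w , last-vertices w) ,
   λ { q (_ , linked , head≡ , last≡) →
       subst (_≤ length q) (sym (length-vertices w)) (path-length q linked head≡ last≡) }) ,
  avoids
  where
  avoids : ∀ {V} → V ∈ vertices w → V ∈ M → V ≡ A ⊎ V ≡ B
  avoids V∈w V∈M with ∈-vertices w V∈w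
  ... | inj₁ V≡A = inj₁ V≡A
  ... | inj₂ av  = av V∈M

-- The remaining pairs are handled by reversing a walk; its first vertex, which `Walk` leaves
-- unconstrained, becomes the last one, where `Avoids` holds trivially.
upwards⇒mutualVisibility : (M : List (Subset n)) →
  (∀ {A B} → A ∈ M → B ∈ M → ∣ A ∣ ≤ ∣ B ∣ → Walk (Avoids M A B) ∣ A △ B ∣ A B) →
  MutualVisibility (Q n) M
upwards⇒mutualVisibility M up {A} {B} A∈M B∈M with ≤-total ∣ A ∣ ∣ B ∣
... | inj₁ A≤B = geodesic⇒visible M (up A∈M B∈M A≤B)
... | inj₂ B≤A = geodesic⇒visible M (subst (λ D → Walk (Avoids M A B) ∣ D ∣ A B) (△-comm B A)
  (mapʷ (λ av V∈M → swap (av V∈M)) (reverseʷ (λ _ → inj₁ refl) (up B∈M A∈M B≤A))))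

-- Monotone and zigzag geodesics.

climb : ∀ k (A : Subset n) → ∣ A ─ B ∣ ≡ 0 → ∣ B ─ A ∣ ≡ k → P B →
        (∀ V → ∣ A ∣ < ∣ V ∣ → ∣ V ∣ < ∣ B ∣ → P V) → Walk P k A B
climb {B = B} {P = P} zero A A─B B─A pB pV =
  subst (Walk P 0 A) (∣p─q∣≡0∧∣q─p∣≡0⇒p≡q A B A─B B─A) []
climb {B = B} {P = P} (suc k) A A─B B─A pB pV with insertTowards A B B─A
... | V , A△V , ∣V∣ , V─B , B─V =
  step A△V (at k B─V) (climb k V (trans V─B A─B) B─V pB
    (λ D V<D → pV D (<-trans (≤-reflexive (sym ∣V∣)) V<D)))
  where
  -- The vertex just reached is `B` itself if nothing remains to be inserted, and otherwise lies
  -- strictly below the layer of `B`.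
  at : ∀ k → ∣ B ─ V ∣ ≡ k → P V
  at zero    B─V = subst P (sym (∣p─q∣≡0∧∣q─p∣≡0⇒p≡q V B (trans V─B A─B) B─V)) pB
  at (suc k) B─V = pV V (≤-reflexive (sym ∣V∣)) (begin-strict
    ∣ V ∣             <⟨ m<m+n ∣ V ∣ (s≤s z≤n) ⟩
    ∣ V ∣ + suc k     ≡⟨ cong (_+_ ∣ V ∣) B─V ⟨
    ∣ V ∣ + ∣ B ─ V ∣ ≡⟨ ∣p∣+∣q─p∣≡∣q∣+∣p─q∣ V B ⟩
    ∣ B ∣ + ∣ V ─ B ∣ ≡⟨ cong (_+_ ∣ B ∣) (trans V─B A─B) ⟩
    ∣ B ∣ + 0         ≡⟨ +-identityʳ ∣ B ∣ ⟩
    ∣ B ∣             ∎)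
    where open ≤-Reasoning

-- Elements of A ∖ B are deleted one at a time, each right after an insertion,
-- so that the walk oscillates between the two layers above that of A until it
-- can end in, or climb monotonically to, B.
module _ (B : Subset n) (r : ℕ) (r≤∣B∣ : r ≤ ∣ B ∣) (pB : P B)
         (pV : ∀ V → r < ∣ V ∣ → ∣ V ∣ ≤ 2 + r ⊎ ∣ V ∣ < ∣ B ∣ → P V) where

  oscillate : ∀ a b (V : Subset n) → ∣ V ∣ ≡ suc r → ∣ V ─ B ∣ ≡ a → ∣ B ─ V ∣ ≡ b →
              Walk P (a + b) V B
  oscillate zero b V ∣V∣ V─B B─V =
    climb b V V─B B─V pB (λ D V<D D<B → pV D (<-trans (≤-reflexive (sym ∣V∣)) V<D) (inj₂ D<B))
  -- Now `B` is contained in `V`, which has only `suc r` elements; as `r ≤ ∣ B ∣`, a single deletion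
  -- must arrive at `B`.
  oscillate (suc a) zero V ∣V∣ V─B B─V with deleteTowards V B V─B
  ... | D , V△D , ∣D∣ , D─B , B─D =
    subst (λ m → Walk P m V B) (trans (cong suc (sym a≡0)) (sym (+-identityʳ (suc a))))
      (step (subst (λ E → ∣ V △ E ∣ ≡ 1) D≡B V△D) pB [])
    where
    B+a≡r : ∣ B ∣ + a ≡ r
    B+a≡r = suc-injective (trans (sym (+-suc ∣ B ∣ a)) (trans (cong (_+_ ∣ B ∣) (sym V─B))
      (trans (sym (∣p∣+∣q─p∣≡∣q∣+∣p─q∣ V B)) (trans (cong₂ _+_ ∣V∣ B─V) (+-identityʳ (suc r))))))
    a≡0 : a ≡ 0
    a≡0 = n≤0⇒n≡0 (+-cancelˡ-≤ ∣ B ∣ a 0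
      (≤-trans (≤-reflexive B+a≡r) (≤-trans r≤∣B∣ (≤-reflexive (sym (+-identityʳ ∣ B ∣))))))
    D≡B : D ≡ B
    D≡B = ∣p─q∣≡0∧∣q─p∣≡0⇒p≡q D B (trans D─B a≡0) (trans B─D B─V)
  oscillate (suc a) (suc b) V ∣V∣ V─B B─V with insertTowards V B B─V
  ... | D , V△D , ∣D∣ , D─B , B─D with deleteTowards D B (trans D─B V─B)
  ...   | E , D△E , ∣E∣ , E─B , B─E =
    step V△D (pV D (≤-trans (n≤1+n _) (≤-reflexive (sym ∣D∣≡))) (inj₁ (≤-reflexive ∣D∣≡)))
      (subst (λ m → Walk P m D B) (sym (+-suc a b))
        (step D△E (pV E (≤-reflexive (sym ∣E∣≡)) (inj₁ (≤-trans (≤-reflexive ∣E∣≡) (n≤1+n _))))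
          (oscillate a b E ∣E∣≡ E─B (trans B─E B─D))))
    where
    ∣D∣≡ : ∣ D ∣ ≡ 2 + r
    ∣D∣≡ = trans ∣D∣ (cong suc ∣V∣)
    ∣E∣≡ : ∣ E ∣ ≡ suc r
    ∣E∣≡ = suc-injective (trans ∣E∣ ∣D∣≡)

  zigzag : ∀ A → ∣ A ∣ ≡ r → Walk P ∣ A △ B ∣ A B
  zigzag A ∣A∣ = subst (λ m → Walk P m A B) (sym (∣p△q∣≡∣p─q∣+∣q─p∣ A B)) (start ∣ B ─ A ∣ refl)
    where
    start : ∀ b → ∣ B ─ A ∣ ≡ b → Walk P (∣ A ─ B ∣ + b) A B
    -- With nothing to insert, `r ≤ ∣ B ∣` leaves nothing to delete either: `A` equals `B`.
    start zero B─A = subst (λ m → Walk P m A B) (cong (_+ 0) (sym A─B))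
      (climb 0 A A─B B─A pB λ D A<D D<B → pV D (subst (_< ∣ D ∣) ∣A∣ A<D) (inj₂ D<B))
      where
      A─B : ∣ A ─ B ∣ ≡ 0
      A─B = n≤0⇒n≡0 (+-cancelˡ-≤ ∣ B ∣ _ _ (begin
        ∣ B ∣ + ∣ A ─ B ∣ ≡⟨ ∣p∣+∣q─p∣≡∣q∣+∣p─q∣ A B ⟨
        ∣ A ∣ + ∣ B ─ A ∣ ≡⟨ cong₂ _+_ ∣A∣ B─A ⟩
        r + 0             ≤⟨ +-monoˡ-≤ 0 r≤∣B∣ ⟩
        ∣ B ∣ + 0         ∎))
        where open ≤-Reasoning
    start (suc b) B─A with insertTowards A B B─A
    ... | V , A△V , ∣V∣ , V─B , B─V =
      subst (λ m → Walk P m A B) (sym (+-suc ∣ A ─ B ∣ b))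
        (step A△V (pV V (≤-reflexive (sym ∣V∣≡)) (inj₁ (≤-trans (≤-reflexive ∣V∣≡) (n≤1+n _))))
          (oscillate ∣ A ─ B ∣ b V ∣V∣≡ V─B B─V))
      where
      ∣V∣≡ : ∣ V ∣ ≡ suc r
      ∣V∣≡ = trans ∣V∣ (cong suc ∣A∣)

-- Mutual visibility of daisy-free layers and of two layers.

infix 4 _∈?_

_∈?_ : (V : Subset n) (M : List (Subset n)) → Dec (V ∈ M)
_∈?_ {n} V = any? (V ≟ᴬ_)
  where open Finite (subsetFinite n)

-- Finiteness and decidable membership turn the negated statement into an actual missing set.
avoidDaisy : ∀ r s t {M : List (Subset n)} (A B : Subset n) → ¬ ContainsDaisy r s t M →
  A ⊆ B → ∣ A ∣ ≡ r ∸ t → ∣ B ∣ ≡ r + s ∸ t →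
  ∃[ T ] ∣ T ∣ ≡ r × A ⊆ T × T ⊆ B × T ∉ M
avoidDaisy {n} r s t {M} A B free A⊆B ∣A∣ ∣B∣ with anySubset? {P = Missing} missing?
  where
  Missing : Subset n → Set
  Missing T = ∣ T ∣ ≡ r × A ⊆ T × T ⊆ B × T ∉ M
  missing? : ∀ T → Dec (Missing T)
  missing? T = (∣ T ∣ ≟ r) ×-dec (A ⊆? T) ×-dec (T ⊆? B) ×-dec ¬? (T ∈? M)
... | yes missing = missing
... | no  none    = ⊥-elim (free
  (A , B , A⊆B , ∣A∣ , ∣B∣ , λ T ∣T∣ A⊆T T⊆B →
    decidable-stable (T ∈? M) λ T∉M → none (T , ∣T∣ , A⊆T , T⊆B , T∉M)))

-- Cancelling `i` and then the factor `d` would leave `a < j < suc a`.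
noMultipleBetween : ∀ i d a {m c} → m ≡ i + a * d → (∃[ j ] c ≡ i + j * d) → m < c → ¬ (c < m + d)
noMultipleBetween i d a refl (j , refl) m<c c<m+d = <⇒≱ a<j (s≤s⁻¹ j<1+a)
  where
  a<j : a < j
  a<j = *-cancelʳ-< d a j (+-cancelˡ-< i _ _ m<c)
  j<1+a : j < suc a
  j<1+a = *-cancelʳ-< d j (suc a) (+-cancelˡ-< i _ _
    (subst (i + j * d <_) (trans (+-assoc i (a * d) d) (cong (_+_ i) (+-comm (a * d) d))) c<m+d))

module _ {n} (M : List (Subset n)) (d i : ℕ) (3≤d : 3 ≤ d)
         (levels : ∀ {V} → V ∈ M → ∃[ j ] ∣ V ∣ ≡ i + j * d)
         (free : ∀ r → d ≤ r → r + d ≤ n → ¬ ContainsDaisy r (2 * d) d M) where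

  private
    -- Since `3 ≤ d`, the two zigzag layers lie strictly between `∣ A ∣` and `∣ A ∣ + d`, as do the
    -- layers climbed before reaching `B`; `M` has no set there.
    short : ∀ {P : Subset n → Set} {A B} a → ∣ A ∣ ≡ i + a * d → ∣ A ∣ ≤ ∣ B ∣ → ∣ B ∣ ≤ ∣ A ∣ + d →
            P B → (∀ {V} → V ∉ M → P V) → Walk P ∣ A △ B ∣ A B
    short {P} {A} {B} a ∣A∣ A≤B B≤A+d pB pV = zigzag B ∣ A ∣ A≤B pB outsideM A refl
      where
      below : ∀ {m} → m ≤ 2 + ∣ A ∣ ⊎ m < ∣ B ∣ → m < ∣ A ∣ + d
      below (inj₁ m≤) = ≤-trans (s≤s m≤) (≤-trans (≤-reflexive (+-comm 3 ∣ A ∣)) (+-monoʳ-≤ ∣ A ∣ 3≤d))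
      below (inj₂ m<) = ≤-trans m< B≤A+d
      outsideM : ∀ V → ∣ A ∣ < ∣ V ∣ → ∣ V ∣ ≤ 2 + ∣ A ∣ ⊎ ∣ V ∣ < ∣ B ∣ → P V
      outsideM V A<V V< = pV λ V∈M →
        noMultipleBetween i d a ∣A∣ (levels V∈M) A<V (below V<)

    -- The next layer above A that may meet M is crossed at a set T outside M,
    -- which exists since M contains no daisy between A₀ and B₀; as A ∩ B ⊆ T ⊆ B,
    -- some geodesic from A to B passes through T.
    gap : ∀ A B → ∣ A ∣ + 2 * d ≤ ∣ B ∣ → ∃[ T ] ∣ T ∣ ≡ ∣ A ∣ + d × A ∩ B ⊆ T × T ⊆ B × T ∉ M
    gap A B far
      with ⊆-interpolate ∣ A ∣ (A ∩ B) B (p∩q⊆q A B) (∣p∩q∣≤∣p∣ A B) (m+n≤o⇒m≤o ∣ A ∣ far)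
    ... | A₀ , A∩B⊆A₀ , A₀⊆B , ∣A₀∣
      with ⊆-interpolate (∣ A ∣ + 2 * d) A₀ B A₀⊆B (≤-trans (≤-reflexive ∣A₀∣) (m≤m+n ∣ A ∣ _)) far
    ... | B₀ , A₀⊆B₀ , B₀⊆B , ∣B₀∣
      -- For `r = ∣ A ∣ + d`, `s = 2 * d` and `t = d`, the lower and upper sets of a daisy have
      -- sizes `∣ A ∣` and `∣ A ∣ + 2 * d`, which is how `A₀` and `B₀` were chosen.
      with avoidDaisy (∣ A ∣ + d) (2 * d) d A₀ B₀ (free (∣ A ∣ + d) (m≤n+m d ∣ A ∣) r+d≤n) A₀⊆B₀
             (trans ∣A₀∣ (sym (m+n∸n≡m ∣ A ∣ d)))
             (trans ∣B₀∣ (sym (trans (cong (_∸ d) (swap-+ ∣ A ∣ d)) (m+n∸n≡m _ d))))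
      where
      swap-+ : ∀ m d → m + d + 2 * d ≡ m + 2 * d + d
      swap-+ = solve-∀
      regroup : ∀ m d → m + d + d ≡ m + 2 * d
      regroup = solve-∀
      r+d≤n : ∣ A ∣ + d + d ≤ n
      r+d≤n = subst (_≤ n) (sym (regroup ∣ A ∣ d)) (≤-trans far (∣p∣≤n B))
    ... | T , ∣T∣ , A₀⊆T , T⊆B₀ , T∉M =
      T , ∣T∣ , ⊆-trans A∩B⊆A₀ A₀⊆T , ⊆-trans T⊆B₀ B₀⊆B , T∉M

    -- Induction on the number `k` of blocks of `d` layers to rise. From two blocks on, the walk
    -- first goes to the set `T` of `gap`; from then on its starting point lies outside `M`, so only
    -- the size of `A` is assumed.
    chain : ∀ {P : Subset n → Set} k {A B} a → ∣ A ∣ ≡ i + a * d → ∣ B ∣ ≡ ∣ A ∣ + k * d →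
            P B → (∀ {V} → V ∉ M → P V) → Walk P ∣ A △ B ∣ A B
    chain zero {A} a ∣A∣ ∣B∣ = short a ∣A∣ (≤-reflexive (sym ∣B∣≡∣A∣))
      (≤-trans (≤-reflexive ∣B∣≡∣A∣) (m≤m+n ∣ A ∣ d))
      where ∣B∣≡∣A∣ = trans ∣B∣ (+-identityʳ ∣ A ∣)
    chain (suc zero) {A} a ∣A∣ ∣B∣ = short a ∣A∣ (≤-trans (m≤m+n ∣ A ∣ _) (≤-reflexive (sym ∣B∣)))
      (≤-reflexive (trans ∣B∣ (cong (_+_ ∣ A ∣) (*-identityˡ d))))
    chain {P} (suc (suc k)) {A} {B} a ∣A∣ ∣B∣ pB pV =
      let T , ∣T∣ , A∩B⊆T , T⊆B , T∉M = gap A B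
            (≤-trans (+-monoʳ-≤ ∣ A ∣ (*-monoˡ-≤ d (s≤s (s≤s (z≤n {k}))))) (≤-reflexive (sym ∣B∣)))
      in subst (λ m → Walk P m A B) (△-between A B T A∩B⊆T T⊆B)
        (short a ∣A∣ (≤-trans (m≤m+n ∣ A ∣ d) (≤-reflexive (sym ∣T∣))) (≤-reflexive ∣T∣) (pV T∉M) pV
         ++ʷ chain (suc k) (suc a)
               (trans ∣T∣ (trans (cong (_+ d) ∣A∣) (next i (a * d) d)))
               (trans ∣B∣ (trans (sym (+-assoc ∣ A ∣ d _)) (cong (_+ suc k * d) (sym ∣T∣)))) pB pV)
      where
      next : ∀ i m d → i + m + d ≡ i + (d + m)
      next = solve-∀

  daisyFree⇒mutualVisibility : MutualVisibility (Q n) M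
  daisyFree⇒mutualVisibility = upwards⇒mutualVisibility M up
    where
    up : ∀ {A B} → A ∈ M → B ∈ M → ∣ A ∣ ≤ ∣ B ∣ → Walk (Avoids M A B) ∣ A △ B ∣ A B
    up {A} {B} A∈M B∈M A≤B with levels A∈M | levels B∈M
    ... | a , ∣A∣ | b , ∣B∣ with a ≤? b
    ...   | yes a≤b = chain (b ∸ a) a ∣A∣ (trans ∣B∣ difference)
                        (λ _ → inj₂ refl) (λ V∉M V∈M → contradiction V∈M V∉M)
      where
      difference : i + b * d ≡ ∣ A ∣ + (b ∸ a) * d
      difference = trans (cong (λ m → i + m * d) (sym (m+[n∸m]≡n a≤b)))
        (trans (cong (_+_ i) (*-distribʳ-+ d a (b ∸ a)))
          (trans (sym (+-assoc i (a * d) _)) (cong (_+ (b ∸ a) * d) (sym ∣A∣))))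
    -- Together with `A≤B` this gives equal sizes, so no block has to be risen.
    ...   | no  a≰b = chain 0 a ∣A∣ (trans (≤-antisym B≤A A≤B) (sym (+-identityʳ ∣ A ∣)))
                        (λ _ → inj₂ refl) (λ V∉M V∈M → contradiction V∈M V∉M)
      where
      B≤A : ∣ B ∣ ≤ ∣ A ∣
      B≤A = subst₂ _≤_ (sym ∣B∣) (sym ∣A∣) (+-monoʳ-≤ i (*-monoˡ-≤ d (<⇒≤ (≰⇒> a≰b))))

-- A zigzag from the layer `r` uses the layers `r + 1` and `r + 2`, both below `s`, and climbs on
-- strictly below its target; a zigzag between two sets of the layer `s` stays above that layer
-- until it ends.
twoLevels⇒mutualVisibility : (M : List (Subset n)) → ∀ {r s} → 3 + r ≤ s →
  (∀ {V} → V ∈ M → ∣ V ∣ ≡ r ⊎ ∣ V ∣ ≡ s) → MutualVisibility (Q n) M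
twoLevels⇒mutualVisibility {n} M {r} {s} r≪s levels = upwards⇒mutualVisibility M up
  where
  up : ∀ {A B} → A ∈ M → B ∈ M → ∣ A ∣ ≤ ∣ B ∣ → Walk (Avoids M A B) ∣ A △ B ∣ A B
  up {A} {B} A∈M B∈M A≤B = zigzag B ∣ A ∣ A≤B (λ _ → inj₂ refl)
    (λ V A<V near V∈M → contradiction near (far (levels A∈M) (levels B∈M) (levels V∈M) A<V))
    A refl
    where
    far : ∀ {a b c} → a ≡ r ⊎ a ≡ s → b ≡ r ⊎ b ≡ s → c ≡ r ⊎ c ≡ s → a < c →
          ¬ (c ≤ 2 + a ⊎ c < b)
    far (inj₁ refl) _           (inj₁ refl) a<c _          = <-irrefl refl a<c
    far (inj₁ refl) _           (inj₂ refl) a<c (inj₁ c≤)  = <⇒≱ r≪s c≤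
    far (inj₁ refl) (inj₁ refl) (inj₂ refl) a<c (inj₂ c<b) = <-asym a<c c<b
    far (inj₁ refl) (inj₂ refl) (inj₂ refl) a<c (inj₂ c<b) = <-irrefl refl c<b
    far (inj₂ refl) _           (inj₁ refl) a<c _          = <⇒≱ a<c (≤-trans (m≤n+m r 3) r≪s)
    far (inj₂ refl) _           (inj₂ refl) a<c _          = <-irrefl refl a<c

-- Finite sums.

∑ : ℕ → (ℕ → ℕ) → ℕ
∑ k f = sum (applyUpTo f k)

∑-cong : ∀ k {f g : ℕ → ℕ} → (∀ {i} → i < k → f i ≡ g i) → ∑ k f ≡ ∑ k g
∑-cong zero    eq = refl
∑-cong (suc k) eq = cong₂ _+_ (eq (s≤s z≤n)) (∑-cong k (λ i<k → eq (s≤s i<k)))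

∑-≤ : ∀ k {f : ℕ → ℕ} {c} → (∀ {i} → i < k → f i ≤ c) → ∑ k f ≤ k * c
∑-≤ zero    le = z≤n
∑-≤ (suc k) le = +-mono-≤ (le (s≤s z≤n)) (∑-≤ k (λ i<k → le (s≤s i<k)))

∑-distrib-+ : ∀ k (f g : ℕ → ℕ) → ∑ k (λ i → f i + g i) ≡ ∑ k f + ∑ k g
∑-distrib-+ zero    f g = refl
∑-distrib-+ (suc k) f g =
  trans (cong (_+_ (f 0 + g 0)) (∑-distrib-+ k (f ∘ suc) (g ∘ suc))) (interchange (f 0) (g 0) _ _)
  where
  interchange : ∀ a b c d → a + b + (c + d) ≡ a + c + (b + d)
  interchange = solve-∀

∑-split : ∀ k l (f : ℕ → ℕ) → ∑ (k + l) f ≡ ∑ k f + ∑ l (λ i → f (k + i))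
∑-split zero    l f = refl
∑-split (suc k) l f = trans (cong (_+_ (f 0)) (∑-split k l (f ∘ suc))) (sym (+-assoc (f 0) _ _))

∑-last : ∀ k (f : ℕ → ℕ) → ∑ (suc k) f ≡ ∑ k f + f k
∑-last zero    f = +-identityʳ (f 0)
∑-last (suc k) f = trans (cong (_+_ (f 0)) (∑-last k (f ∘ suc))) (sym (+-assoc (f 0) _ _))

∑-reverse : ∀ k (f : ℕ → ℕ) → ∑ k (λ i → f (k ∸ suc i)) ≡ ∑ k f
∑-reverse zero    f = refl
∑-reverse (suc k) f =
  trans (cong (_+_ (f k)) (∑-reverse k f)) (trans (+-comm (f k) _) (sym (∑-last k f)))

∑-monoˡ-≤ : ∀ {k l} (f : ℕ → ℕ) → k ≤ l → ∑ k f ≤ ∑ l f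
∑-monoˡ-≤ {k} {l} f k≤l = begin
  ∑ k f                                  ≤⟨ m≤m+n (∑ k f) _ ⟩
  ∑ k f + ∑ (l ∸ k) (λ i → f (k + i))    ≡⟨ ∑-split k (l ∸ k) f ⟨
  ∑ (k + (l ∸ k)) f                      ≡⟨ cong (λ m → ∑ m f) (m+[n∸m]≡n k≤l) ⟩
  ∑ l f                                  ∎
  where open ≤-Reasoning

-- Induction on `J`: the last block of `d` consecutive indices contributes one term to each residue
-- class.
∑-residues : ∀ d J (f : ℕ → ℕ) → ∑ (J * d) f ≡ ∑ d (λ i → ∑ J (λ j → f (i + j * d)))
∑-residues d zero    f = sym (n≤0⇒n≡0 (≤-trans (∑-≤ d (λ _ → z≤n)) (≤-reflexive (*-zeroʳ d))))
∑-residues d (suc J) f = begin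
  ∑ (d + J * d) f                                                   ≡⟨ cong (λ m → ∑ m f) (+-comm d (J * d)) ⟩
  ∑ (J * d + d) f                                                   ≡⟨ ∑-split (J * d) d f ⟩
  ∑ (J * d) f + ∑ d (λ i → f (J * d + i))                           ≡⟨ cong₂ _+_ (∑-residues d J f)
                                                                        (∑-cong d λ {i} _ → cong f (+-comm (J * d) i)) ⟩
  ∑ d (λ i → ∑ J (λ j → f (i + j * d))) + ∑ d (λ i → f (i + J * d)) ≡⟨ ∑-distrib-+ d _ _ ⟨
  ∑ d (λ i → ∑ J (λ j → f (i + j * d)) + f (i + J * d))             ≡⟨ ∑-cong d (λ {i} _ → ∑-last J (λ j → f (i + j * d))) ⟨
  ∑ d (λ i → ∑ (suc J) (λ j → f (i + j * d)))                       ∎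
  where open ≡-Reasoning

-- By the symmetry of binomial coefficients, the top `d` layers have the sizes of the bottom `d`
-- layers in reverse order.
∑-nCk-top : ∀ n a d → a + d ≡ suc n → ∑ d (λ i → n C (a + i)) ≡ ∑ d (n C_)
∑-nCk-top n a d a+d≡1+n = trans (∑-cong d mirror) (∑-reverse d (n C_))
  where
  mirror : ∀ {i} → i < d → n C (a + i) ≡ n C (d ∸ suc i)
  mirror {i} i<d = trans (nCk≡nC[n∸k] a+i≤n) (cong (n C_) (begin
    suc n ∸ suc (a + i)   ≡⟨ cong₂ _∸_ a+d≡1+n (+-suc a i) ⟨
    a + d ∸ (a + suc i)   ≡⟨ [m+n]∸[m+o]≡n∸o a d (suc i) ⟩
    d ∸ suc i             ∎))
    where
    open ≡-Reasoning
    a+i≤n : a + i ≤ n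
    a+i≤n = s≤s⁻¹ (subst₂ _≤_ (+-suc a i) a+d≡1+n (+-monoʳ-≤ a i<d))

-- Full layers of the cube.

layer : ∀ n → ℕ → List (Subset n)
layer zero    zero    = [] ∷ []
layer zero    (suc r) = []
layer (suc n) zero    = map (outside ∷_) (layer n zero)
layer (suc n) (suc r) = map (inside ∷_) (layer n r) ++ map (outside ∷_) (layer n (suc r))

length-layer : ∀ n r → length (layer n r) ≡ n C r
length-layer zero    zero    = refl
length-layer zero    (suc r) = sym (k>n⇒nCk≡0 {0} {suc r} (s≤s z≤n))
length-layer (suc n) zero    =
  trans (length-map _ (layer n 0)) (trans (length-layer n 0) (trans (nC0≡1 n) (sym (nC0≡1 (suc n)))))
  where
  nC0≡1 : ∀ n → n C 0 ≡ 1
  nC0≡1 n = trans (nCk≡nC[n∸k] {0} {n} z≤n) (nCn≡1 n)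
length-layer (suc n) (suc r) = trans (length-++ (map (inside ∷_) (layer n r)))
  (trans (cong₂ _+_ (trans (length-map _ (layer n r)) (length-layer n r))
                    (trans (length-map _ (layer n (suc r))) (length-layer n (suc r))))
         (nCk+nC[k+1]≡[n+1]C[k+1] n r))

layer-uniform : ∀ n r → UniformFamily r (layer n r)
layer-uniform zero    zero    = refl ∷ []
layer-uniform zero    (suc r) = []
layer-uniform (suc n) zero    = All.map⁺ (layer-uniform n zero)
layer-uniform (suc n) (suc r) =
  All.++⁺ (All.map⁺ (All.map (cong suc) (layer-uniform n r))) (All.map⁺ (layer-uniform n (suc r)))

layer-unique : ∀ n r → Unique (layer n r)
layer-unique zero    zero    = [] ∷ []
layer-unique zero    (suc r) = []
layer-unique (suc n) zero    = map⁺ ∷-injectiveʳ (layer-unique n zero)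
layer-unique (suc n) (suc r) = ++⁺ (map⁺ ∷-injectiveʳ (layer-unique n r))
  (map⁺ ∷-injectiveʳ (layer-unique n (suc r))) inside≢outside
  where
  inside≢outside : Disjoint (map (inside ∷_) (layer n r)) (map (outside ∷_) (layer n (suc r)))
  inside≢outside (x∈ , y∈) with ∈-map⁻ (inside ∷_) x∈ | ∈-map⁻ (outside ∷_) y∈
  ... | _ , _ , refl | _ , _ , ()

mutualVisibility⇒length≤μ : {M : List (Subset n)} → Unique M → MutualVisibility (Q n) M →
                            length M ≤ μ (Q n)
mutualVisibility⇒length≤μ {n} = largestSize-bound (subsetFinite n) (mutualVisibility? (Q n))

twoLayers≤μ : ∀ n {r s} → 3 + r ≤ s → n C r + n C s ≤ μ (Q n)
twoLayers≤μ n {r} {s} r≪s = subst (_≤ μ (Q n))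
  (trans (length-++ (layer n r)) (cong₂ _+_ (length-layer n r) (length-layer n s)))
  (mutualVisibility⇒length≤μ
    (++⁺ (layer-unique n r) (layer-unique n s) disjoint)
    (twoLevels⇒mutualVisibility _ r≪s
      (λ V∈M → Sum.map (All.lookup (layer-uniform n r)) (All.lookup (layer-uniform n s))
                       (∈-++⁻ (layer n r) V∈M))))
  where
  disjoint : Disjoint (layer n r) (layer n s)
  disjoint (V∈r , V∈s) = <⇒≢ (≤-trans (m≤n+m (suc r) 2) r≪s)
    (trans (sym (All.lookup (layer-uniform n r) V∈r)) (All.lookup (layer-uniform n s) V∈s))

-- Averaging over residue classes, for n at least 2d.

module _ {n} (d : ℕ) (3≤d : 3 ≤ d) (𝓕 : ℕ → List (Subset n))
         (unique : ∀ r → Unique (𝓕 r)) (uniform : ∀ r → UniformFamily r (𝓕 r))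
         (free : ∀ r → d ≤ r → r + d ≤ n → ¬ ContainsDaisy r (2 * d) d (𝓕 r)) where

  private
    residueClass : ℕ → ℕ → List (Subset n)
    residueClass i zero    = []
    residueClass i (suc J) = residueClass i J ++ 𝓕 (i + J * d)

    ∈-residueClass : ∀ i J {V} → V ∈ residueClass i J → ∃[ j ] j < J × V ∈ 𝓕 (i + j * d)
    ∈-residueClass i (suc J) V∈ with ∈-++⁻ (residueClass i J) V∈
    ... | inj₁ V∈′ = let j , j<J , V∈𝓕 = ∈-residueClass i J V∈′ in j , m≤n⇒m≤1+n j<J , V∈𝓕
    ... | inj₂ V∈𝓕 = J , ≤-refl , V∈𝓕

    length-residueClass : ∀ i J → length (residueClass i J) ≡ ∑ J (λ j → length (𝓕 (i + j * d)))
    length-residueClass i zero    = refl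
    length-residueClass i (suc J) = trans (length-++ (residueClass i J))
      (trans (cong (_+ _) (length-residueClass i J)) (sym (∑-last J _)))

    residueClass-unique : ∀ i J → Unique (residueClass i J)
    residueClass-unique i zero    = []
    residueClass-unique i (suc J) = ++⁺ (residueClass-unique i J) (unique _) disjoint
      where
      disjoint : Disjoint (residueClass i J) (𝓕 (i + J * d))
      disjoint (V∈ , V∈J) =
        let j , j<J , V∈j = ∈-residueClass i J V∈
        in <⇒≢ (+-monoʳ-< i (*-monoˡ-< d {{>-nonZero (≤-trans (s≤s z≤n) 3≤d)}} j<J))
             (trans (sym (All.lookup (uniform _) V∈j)) (All.lookup (uniform _) V∈J))

    residueClass-visible : ∀ i J → MutualVisibility (Q n) (residueClass i J)
    residueClass-visible i J = daisyFree⇒mutualVisibility _ d i 3≤d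
      (λ V∈ → let j , _ , V∈𝓕 = ∈-residueClass i J V∈ in j , All.lookup (uniform _) V∈𝓕)
      -- A daisy consists of `r`-sets, and the `r`-sets of the class all come from `𝓕 r`.
      (λ { r d≤r r≤n (A , B , A⊆B , ∣A∣ , ∣B∣ , all) → free r d≤r r≤n
         (A , B , A⊆B , ∣A∣ , ∣B∣ , λ T ∣T∣ A⊆T T⊆B →
           let j , _ , T∈𝓕 = ∈-residueClass i J (all T ∣T∣ A⊆T T⊆B)
           in subst (λ m → T ∈ 𝓕 m) (trans (sym (All.lookup (uniform _) T∈𝓕)) ∣T∣) T∈𝓕) })

  daisyFreeFamilies≤d*μ : ∑ (suc n) (length ∘ 𝓕) ≤ d * μ (Q n)
  daisyFreeFamilies≤d*μ = begin
    ∑ (suc n) (length ∘ 𝓕)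
      -- Lengthening the range to a multiple of `d` gives every residue class the same number of
      -- terms.
      ≤⟨ ∑-monoˡ-≤ _ (m≤m*n (suc n) d {{>-nonZero (≤-trans (s≤s z≤n) 3≤d)}}) ⟩
    ∑ (suc n * d) (length ∘ 𝓕)
      ≡⟨ ∑-residues d (suc n) (length ∘ 𝓕) ⟩
    ∑ d (λ i → ∑ (suc n) (λ j → length (𝓕 (i + j * d))))
      ≤⟨ ∑-≤ d (λ {i} _ → subst (_≤ μ (Q n)) (length-residueClass i (suc n))
           (mutualVisibility⇒length≤μ (residueClass-unique i (suc n)) (residueClass-visible i (suc n)))) ⟩
    d * μ (Q n) ∎
    where open ≤-Reasoning

-- Attaining the maximum takes one admissible family. The empty one serves, because every daisy with
-- these parameters has a member.
maximalDaisyFree : ∀ n d r → d ≤ r → r + d ≤ n →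
  ∃[ 𝓕 ] Unique 𝓕 × DaisyFreeFamily {n} r (2 * d) d 𝓕 × length 𝓕 ≡ ex n r (2 * d) d
maximalDaisyFree n d r d≤r r+d≤n =
  largestSize-attained (subsetFinite n) (daisyFreeFamily? r (2 * d) d) [] ([] , noDaisy)
  where
  noDaisy : ¬ ContainsDaisy {n} r (2 * d) d []
  noDaisy (A , B , A⊆B , ∣A∣ , ∣B∣ , all)
    with ⊆-interpolate r A B A⊆B (≤-trans (≤-reflexive ∣A∣) (m∸n≤m r d))
           (≤-trans (≤-trans (m≤m+n r d) (≤-reflexive r+d≡∣B∣)) (≤-reflexive (sym ∣B∣)))
    where
    r+d≡∣B∣ : r + d ≡ r + 2 * d ∸ d
    r+d≡∣B∣ = sym (trans (cong (_∸ d) (regroup r d)) (m+n∸n≡m (r + d) d))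
      where
      regroup : ∀ r d → r + 2 * d ≡ r + d + d
      regroup = solve-∀
  ... | T , A⊆T , T⊆B , ∣T∣ with () ← all T ∣T∣ A⊆T T⊆B

module _ (k d : ℕ) (3≤d : 3 ≤ d) (d≤k : d ≤ k) where
  private
    N = k + d

    -- An extremal daisy-free family for `d ≤ r ≤ k`, where `k` is `N ∸ d`, and the full layer for
    -- all other `r`.
    Family : ℕ → Set
    Family r = ∃[ 𝓕 ] Unique 𝓕 × UniformFamily {N} r 𝓕 ×
      (d ≤ r → r + d ≤ N → ¬ ContainsDaisy r (2 * d) d 𝓕) ×
      (¬ (d ≤ r × r ≤ k) → length 𝓕 ≡ N C r) ×
      (d ≤ r → r ≤ k → length 𝓕 ≡ ex N r (2 * d) d)

    family : ∀ r → Family r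
    family r with (d ≤? r) ×-dec (r ≤? k)
    ... | yes (d≤r , r≤k) =
      let 𝓕 , unique , (uniform , free) , length𝓕 = maximalDaisyFree N d r d≤r (+-monoˡ-≤ d r≤k)
      in 𝓕 , unique , uniform , (λ _ _ → free) , (λ ¬mid → contradiction (d≤r , r≤k) ¬mid) ,
         λ _ _ → length𝓕
    ... | no ¬mid = layer N r , layer-unique N r , layer-uniform N r ,
      (λ d≤r r+d≤n → contradiction (d≤r , +-cancelʳ-≤ d r k r+d≤n) ¬mid) ,
      (λ _ → length-layer N r) , λ d≤r r≤k → contradiction (d≤r , r≤k) ¬mid

    𝓕 : ℕ → List (Subset N)
    𝓕 r = proj₁ (family r)

    outer : ∀ r → ¬ (d ≤ r × r ≤ k) → length (𝓕 r) ≡ N C r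
    outer r = let _ , _ , _ , _ , len , _ = family r in len

    middle : ∀ r → d ≤ r → r ≤ k → length (𝓕 r) ≡ ex N r (2 * d) d
    middle r = let _ , _ , _ , _ , _ , len = family r in len

    e = suc k ∸ d

    d+e≡1+k : d + e ≡ suc k
    d+e≡1+k = m+[n∸m]≡n (m≤n⇒m≤1+n d≤k)

    -- The layers from 0 to `N` split into `d` full ones at the bottom, `e` extremal ones, and `d`
    -- full ones at the top.
    sizes : ∑ (suc N) (length ∘ 𝓕) ≡ ∑ d (N C_) + ∑ e (λ i → ex N (d + i) (2 * d) d) + ∑ d (N C_)
    sizes = begin
      ∑ (suc k + d) (length ∘ 𝓕)
        ≡⟨ ∑-split (suc k) d (length ∘ 𝓕) ⟩
      ∑ (suc k) (length ∘ 𝓕) + ∑ d (λ i → length (𝓕 (suc k + i)))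
        ≡⟨ cong₂ _+_ (cong (λ m → ∑ m (length ∘ 𝓕)) (sym d+e≡1+k))
             (∑-cong d λ {i} _ → outer _ λ (_ , ≤k) → <⇒≱ (s≤s (m≤m+n k i)) ≤k) ⟩
      ∑ (d + e) (length ∘ 𝓕) + ∑ d (λ i → N C (suc k + i))
        ≡⟨ cong₂ _+_ (∑-split d e (length ∘ 𝓕)) (∑-nCk-top N (suc k) d refl) ⟩
      ∑ d (length ∘ 𝓕) + ∑ e (λ i → length (𝓕 (d + i))) + ∑ d (N C_)
        ≡⟨ cong (_+ ∑ d (N C_)) (cong₂ _+_
             (∑-cong d λ i<d → outer _ λ (d≤i , _) → <⇒≱ i<d d≤i)
             (∑-cong e λ {i} i<e → middle _ (m≤m+n d i)
               (s≤s⁻¹ (subst₂ _≤_ (+-suc d i) d+e≡1+k (+-monoʳ-≤ d i<e))))) ⟩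
      ∑ d (N C_) + ∑ e (λ i → ex N (d + i) (2 * d) d) + ∑ d (N C_) ∎
      where open ≡-Reasoning

  bound-2d≤n : ∑ (suc k ∸ d) (λ i → ex (k + d) (d + i) (2 * d) d) + 2 * ∑ d ((k + d) C_)
               ≤ d * μ (Q (k + d))
  bound-2d≤n = subst (_≤ d * μ (Q N)) (trans sizes (rearrange (∑ d (N C_)) _))
    (daisyFreeFamilies≤d*μ d 3≤d 𝓕
      (λ r → let _ , unique , _ = family r in unique)
      (λ r → let _ , _ , uniform , _ = family r in uniform)
      (λ r → let _ , _ , _ , free , _ = family r in free))
    where
    rearrange : ∀ a b → a + b + a ≡ b + 2 * a
    rearrange = solve-∀

-- Pairing full layers, for n below 2d.

-- A record rather than a synonym: comparing two instances with literal
-- arguments must not evaluate μ.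
record DoubleSum≤ (n d : ℕ) : Set where
  constructor doubleSum≤
  field proof : 2 * ∑ d (n C_) ≤ d * μ (Q n)

module _ (n : ℕ) where
  private
    f : ℕ → ℕ
    f = n C_

  -- One of the two copies of the lower sum is traded for the top `d` layers, which start at `a`;
  -- this gives the multiset of layers to be paired.
  bound-from-pairs : ∀ a d → a + d ≡ suc n → ∑ d f + ∑ d (λ i → f (a + i)) ≤ d * μ (Q n) →
                     DoubleSum≤ n d
  bound-from-pairs a d a+d≡1+n pairs = doubleSum≤ (subst (_≤ d * μ (Q n))
    (trans (cong (_+_ (∑ d f)) (∑-nCk-top n a d a+d≡1+n)) (cong (_+_ (∑ d f)) (sym (+-identityʳ _)))) pairs)

  pairs≤ : ∀ a d → 3 ≤ a → ∑ d f + ∑ d (λ i → f (a + i)) ≤ d * μ (Q n)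
  pairs≤ a d 3≤a = subst (_≤ d * μ (Q n)) (∑-distrib-+ d f _)
    (∑-≤ d λ {i} _ → twoLayers≤μ n (+-monoˡ-≤ i 3≤a))

-- The `i`-th lowest layer is paired with the `i`-th of the top `d` layers, at distance `suc k`,
-- which is at least 3.
bound-n≥d+2 : ∀ k d → 2 ≤ k → DoubleSum≤ (k + d) d
bound-n≥d+2 k d 2≤k = bound-from-pairs (k + d) (suc k) d refl (pairs≤ (k + d) (suc k) d (s≤s 2≤k))

-- The layers i and i + 3 are paired for i < m; then 1 with m and 2 with m + 1.
bound-n≡d : ∀ m → 4 ≤ m → DoubleSum≤ (2 + m) (2 + m)
bound-n≡d m 4≤m = bound-from-pairs N 1 N refl (begin
  ∑ (2 + m) f + (f 1 + (f 2 + ∑ m (λ i → f (3 + i))))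
    ≡⟨ cong (_+ (f 1 + (f 2 + ∑ m (λ i → f (3 + i))))) (trans (∑-last (suc m) f) (cong (_+ f (suc m)) (∑-last m f))) ⟩
  ∑ m f + f m + f (suc m) + (f 1 + (f 2 + ∑ m (λ i → f (3 + i))))
    ≡⟨ rearrange (∑ m f) (f m) (f (suc m)) (f 1) (f 2) _ ⟩
  f 1 + f m + (f 2 + f (suc m) + (∑ m f + ∑ m (λ i → f (3 + i))))
    ≤⟨ +-mono-≤ (twoLayers≤μ N 4≤m) (+-mono-≤ (twoLayers≤μ N (s≤s 4≤m)) (pairs≤ N 3 m ≤-refl)) ⟩
  (2 + m) * μ (Q N) ∎)
  where
  open ≤-Reasoning
  N = 2 + m
  f = N C_
  rearrange : ∀ s a b c d t → s + a + b + (c + (d + t)) ≡ c + a + (d + b + (s + t))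
  rearrange = solve-∀

-- The layers i and i + 3 are paired for i < m, and 2 with m.
bound-n≡d+1 : ∀ m → 5 ≤ m → DoubleSum≤ (2 + m) (1 + m)
bound-n≡d+1 m 5≤m = bound-from-pairs N 2 (1 + m) refl (begin
  ∑ (1 + m) f + (f 2 + ∑ m (λ i → f (3 + i)))
    ≡⟨ cong (_+ (f 2 + ∑ m (λ i → f (3 + i)))) (∑-last m f) ⟩
  ∑ m f + f m + (f 2 + ∑ m (λ i → f (3 + i)))
    ≡⟨ rearrange (∑ m f) (f m) (f 2) _ ⟩
  f 2 + f m + (∑ m f + ∑ m (λ i → f (3 + i)))
    ≤⟨ +-mono-≤ (twoLayers≤μ N 5≤m) (pairs≤ N 3 m ≤-refl) ⟩
  (1 + m) * μ (Q N) ∎)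
  where
  open ≤-Reasoning
  N = 2 + m
  f = N C_
  rearrange : ∀ s a c t → s + a + (c + t) ≡ c + a + (s + t)
  rearrange = solve-∀

-- Small cubes by computation.

-- These are only candidates for the next vertex of a geodesic: the search in `geodesic?` tests
-- adjacency itself, so a walk it finds is its own certificate.
neighboursTowards : ∀ {n} → Subset n → Subset n → List (Subset n)
neighboursTowards []      []      = []
neighboursTowards (a ∷ A) (b ∷ B) =
  (if a xor b then (b ∷ A) ∷ [] else []) ++ map (a ∷_) (neighboursTowards A B)

module _ {n} {P : Subset n → Set} (P? : Decidable P) where
  open Finite (subsetFinite n)

  geodesic? : ∀ k A B → Maybe (Walk P k A B)
  geodesic? zero    A B with A ≟ᴬ B
  ... | yes refl = just []
  ... | no  _    = nothing
  geodesic? (suc k) A B = foldr (λ V found → via V <∣> found) nothing (neighboursTowards A B)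
    where
    via : Subset n → Maybe (Walk P (suc k) A B)
    via V = dec⇒maybe (∣ A △ V ∣ ≟ 1) >>= λ e → dec⇒maybe (P? V) >>= λ p →
            geodesic? k V B >>= λ w → just (step e p w)

module _ {n} (M : List (Subset n)) where
  open Finite (subsetFinite n)

  avoids? : ∀ A B → Decidable (Avoids M A B)
  avoids? A B V = (V ∈? M) →-dec ((V ≟ᴬ A) ⊎-dec (V ≟ᴬ B))

  allVisible : Bool
  allVisible = all (λ A → all (λ B → is-just (geodesic? (avoids? A B) ∣ A △ B ∣ A B)) M) M

  allVisible⇒length≤μ : T allVisible → True (unique? _≟ᴬ_ M) → length M ≤ μ (Q n)
  allVisible⇒length≤μ visible unique =
    mutualVisibility⇒length≤μ (toWitness unique)
      λ {A} {B} A∈M B∈M → geodesic⇒visible M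
        (fromJust _ (All.lookup (All.all⁺ _ M (All.lookup (All.all⁺ _ M visible) A∈M)) B∈M))
    where
    fromJust : {X : Set} (m : Maybe X) → T (is-just m) → X
    fromJust (just x) _ = x

-- Bit masks, lowest bit first, as a compact notation for the explicit sets.
fromBinary : ∀ n → ℕ → Subset n
fromBinary zero    m = []
fromBinary (suc n) m = (m % 2 ≡ᵇ 1) ∷ fromBinary n ⌊ m /2⌋

-- The sizes 5, 8, 13 and 23 are the least integers for which the inequalities needed in
-- `doubleSum-bound` hold; for instance 5 is 14/3 rounded up and 23 is 114/5 rounded up.
5≤μ[Q3] : 5 ≤ μ (Q 3)
5≤μ[Q3] = allVisible⇒length≤μ (map (fromBinary 3) (0 ∷ 2 ∷ 3 ∷ 4 ∷ 7 ∷ [])) tt tt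

8≤μ[Q4] : 8 ≤ μ (Q 4)
8≤μ[Q4] = allVisible⇒length≤μ
  (map (fromBinary 4) (0 ∷ 3 ∷ 4 ∷ 7 ∷ 8 ∷ 9 ∷ 13 ∷ 15 ∷ [])) tt tt

13≤μ[Q5] : 13 ≤ μ (Q 5)
13≤μ[Q5] = allVisible⇒length≤μ (map (fromBinary 5)
  (1 ∷ 3 ∷ 6 ∷ 8 ∷ 9 ∷ 15 ∷ 16 ∷ 20 ∷ 21 ∷ 22 ∷ 24 ∷ 30 ∷ 31 ∷ [])) tt tt

23≤μ[Q6] : 23 ≤ μ (Q 6)
23≤μ[Q6] = allVisible⇒length≤μ (map (fromBinary 6)
  (0 ∷ 4 ∷ 5 ∷ 7 ∷ 8 ∷ 10 ∷ 11 ∷ 18 ∷ 21 ∷ 25 ∷ 27 ∷ 28 ∷ 32 ∷ 38 ∷ 39 ∷ 41 ∷ 48 ∷ 49 ∷ 50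
     ∷ 53 ∷ 58 ∷ 60 ∷ 63 ∷ [])) tt tt

numerically : ∀ n d {c} → c ≤ μ (Q n) → True (2 * ∑ d (n C_) ≤? d * c) → DoubleSum≤ n d
numerically n d c≤μ small = doubleSum≤ (≤-trans (toWitness small) (*-monoʳ-≤ d c≤μ))

-- Combining the cases and passing to rationals.

-- Here `k` is n - d. For `k` equal to 0 or 1 the modified pairings work once `d` is at least 6,
-- which leaves `d` equal to 3, 4 or 5 to the explicit sets.
doubleSum-bound : ∀ k d → 3 ≤ d → DoubleSum≤ (k + d) d
doubleSum-bound 0 3 _ = numerically 3 3 5≤μ[Q3] tt
doubleSum-bound 0 4 _ = numerically 4 4 8≤μ[Q4] tt
doubleSum-bound 0 5 _ = numerically 5 5 13≤μ[Q5] tt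
doubleSum-bound 1 3 _ = numerically 4 3 8≤μ[Q4] tt
doubleSum-bound 1 4 _ = numerically 5 4 13≤μ[Q5] tt
doubleSum-bound 1 5 _ = numerically 6 5 23≤μ[Q6] tt
doubleSum-bound 0 (suc (suc m@(suc (suc (suc (suc _)))))) _ = bound-n≡d m (m≤m+n 4 _)
doubleSum-bound 1 (suc m@(suc (suc (suc (suc (suc _)))))) _ = bound-n≡d+1 m (m≤m+n 5 _)
doubleSum-bound k@(suc (suc _)) d _ = bound-n≥d+2 k d (m≤m+n 2 _)
doubleSum-bound 0 1 (s≤s ())
doubleSum-bound 0 2 (s≤s (s≤s ()))
doubleSum-bound 1 1 (s≤s ())
doubleSum-bound 1 2 (s≤s (s≤s ()))

bound : ∀ k d → 3 ≤ d →
  ∑ (suc k ∸ d) (λ i → ex (k + d) (d + i) (2 * d) d) + 2 * ∑ d ((k + d) C_) ≤ d * μ (Q (k + d))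
bound k d 3≤d = [ bound-2d≤n k d 3≤d , n<2d ]′ (≤-<-connex d k)
  where
  n<2d : k < d → _
  -- The range of the sum of Turán numbers has `suc k ∸ d` terms, which is 0 here.
  n<2d k<d = subst
    (λ e → ∑ e (λ i → ex (k + d) (d + i) (2 * d) d) + 2 * ∑ d ((k + d) C_) ≤ d * μ (Q (k + d)))
    (sym (m≤n⇒m∸n≡0 k<d)) (DoubleSum≤.proof (doubleSum-bound k d 3≤d))

-- In unnormalised rationals the claim is a comparison of cross products, free of reductions to
-- lowest terms.
1/d*m≤n : ∀ d .{{_ : NonZero d}} {m n} → m ≤ d * n → fromℕ n ≥ (+ 1 / d) *ᴿ fromℕ m
1/d*m≤n (suc d) {m} {n} m≤d*n = ℚ.toℚᵘ-cancel-≤ (begin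
  ℚ.toℚᵘ ((+ 1 / suc d) *ᴿ fromℕ m)              ≃⟨ ℚ.toℚᵘ-homo-* (+ 1 / suc d) (fromℕ m) ⟩
  ℚ.toℚᵘ (+ 1 / suc d) ℚᵘ.* ℚ.toℚᵘ (fromℕ m)     ≃⟨ ℚᵘ.*-cong (ℚ.toℚᵘ-fromℚᵘ (ℚᵘ.mkℚᵘ (+ 1) d))
                                                                (ℚ.toℚᵘ-fromℚᵘ (ℚᵘ.mkℚᵘ (+ m) 0)) ⟩
  ℚᵘ.mkℚᵘ (+ 1) d ℚᵘ.* ℚᵘ.mkℚᵘ (+ m) 0           ≤⟨ ℚᵘ.*≤* (subst₂ ℤ._≤_
                                                       (sym (trans (ℤ.*-identityʳ _) (ℤ.*-identityˡ (+ m))))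
                                                       (trans (cong +_ (sym rhs)) (ℤ.pos-* n (suc d * 1)))
                                                       (ℤ.+≤+ m≤d*n)) ⟩
  ℚᵘ.mkℚᵘ (+ n) 0                                ≃⟨ ℚ.toℚᵘ-fromℚᵘ (ℚᵘ.mkℚᵘ (+ n) 0) ⟨
  ℚ.toℚᵘ (fromℕ n)                               ∎)
  where
  open ℚᵘ.≤-Reasoning
  rhs : n * (suc d * 1) ≡ suc d * n
  rhs = trans (cong (n *_) (*-identityʳ (suc d))) (*-comm n (suc d))

theorem1p3 : (n d : ℕ) .{{_ : NonZero n}} .{{_ : NonZero d}} → n ≥ᴺ d → d ≥ᴺ 3 →
    fromℕ (μ (Q n)) ≥
    (+ 1 / d) *ᴿ fromℕ ((Σ[ r from d to (n ∸ d) ] ex n r (2 * d) d) + 2 * (Σ[ r from 0 to (d ∸ 1) ] (n C r)))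
-- Exposing the successor lets `suc (d ∸ 1)`, the number of terms of the binomial sum, compute to
-- `d`.
theorem1p3 n d@(suc _) d≤n 3≤d = 1/d*m≤n d (subst
  (λ m → ∑ (suc (n ∸ d) ∸ d) (λ i → ex m (d + i) (2 * d) d) + 2 * ∑ d (m C_) ≤ d * μ (Q m))
  (m∸n+n≡m d≤n) (bound (n ∸ d) d 3≤d))
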